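{- Let $\langle A,\to\rangle$ be a conditional algebra, and write $T=T_A$, with $u,v,w$ ranging over $\mathrm{Ul}(A)$ and $Y,Z$ over closed subsets of the Stone space $\mathrm{Ul}(A)$. Then: (A4) $a\to b\le c\to(a\to b)$ holds for all $a,b,c\in A$ iff for all $u,v,w,Y,Z$: $T(u,Y,v)$ and $T(v,Z,w)$ imply $T(u,Z,w)$; (A5) $a\wedge(a\to b)\le b$ holds for all $a,b$ iff $T(u,\{u\},u)$ for all $u$; (A6) $a\to b\le\neg b\to\neg a$ holds for all $a,b$ iff for all $u,v,Y$: $T(u,Y,v)$ implies there is $w\in Y$ with $T(u,\{v\},w)$; (A7) $\neg(a\to b)\le c\to\neg(a\to b)$ holds for all $a,b,c$ iff for all $u,v,w,Y,Z$: $T(u,Y,v)$ and $T(u,Z,w)$ imply $T(v,Z,w)$; (A8) $(1\to(\neg a\vee b))\wedge(b\to c)\le a\to c$ holds for all $a,b,c$ iff for all $u,v,Y,Z$: if $T(u,Y,v)$ and $T(u,\mathrm{Ul}(A))\cap Y\subseteq Z$, then $T(u,Z,v)$.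
   Context: A conditional algebra is $\langle A,\to\rangle$ with $A$ a Boolean algebra and $\to$ binary with $a\to1=1$, $(a\to b)\wedge(a\to c)=a\to(b\wedge c)$, $(a\vee b)\to c\le(a\to c)\wedge(b\to c)$. $\mathrm{Ul}(A)$ is the Stone space of ultrafilters; its closed sets are the $\varphi(F)=\{u:F\subseteq u\}$ for filters $F$ (including $F=A$, giving $\emptyset$). $D^{\to}_u(F)=\{b:\exists a\in F,\ a\to b\in u\}$; $T_A(u,Z,v)$ iff there is a filter $F$ with $Z=\varphi(F)$ and $D^{\to}_u(F)\subseteq v$; $T_A(u,Z)=\{v:T_A(u,Z,v)\}$. -}

module Defs where

open import Level using (Level; _⊔_; suc)
open import Algebra.Core using (Op₂)
open import Algebra.Definitions using (Congruent₂)
open import Algebra.Lattice.Bundles using (BooleanAlgebra)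
import Algebra.Lattice.Properties.BooleanAlgebra as BooleanAlgebraProperties
open import Data.Product using (∃-syntax; _×_)
open import Data.Sum using (_⊎_)
open import Relation.Binary.Bundles using (Poset)
import Relation.Binary.Lattice.Bundles as OrderTheoretic
open import Relation.Binary.Core using (Rel)
open import Relation.Nullary.Negation using () renaming (¬_ to Not_)
open import Relation.Unary using (Pred; _∈_; _⊆_; _≐_)

-- Chains are arbitrary, possibly empty, subsets, so the hypothesis
-- `every chain has an upper bound' also gives an element of P.
ZornsLemma : ∀ a ℓ₁ ℓ₂ → Set (suc (a ⊔ ℓ₁ ⊔ ℓ₂))
ZornsLemma a ℓ₁ ℓ₂ =
  (P : Poset a ℓ₁ ℓ₂) → let open Poset P using (Carrier; _≤_) in
  ((C : Pred Carrier a) →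
    (∀ {x y} → x ∈ C → y ∈ C → x ≤ y ⊎ y ≤ x) →
    ∃[ b ] (∀ {x} → x ∈ C → x ≤ b)) →
  ∃[ m ] (∀ {x} → m ≤ x → x ≤ m)

record ConditionalAlgebra (c ℓ : Level) : Set (suc (c ⊔ ℓ)) where
  infixr 5 _⇾_
  infix  4 _≤_
  field
    booleanAlgebra : BooleanAlgebra c ℓ

  open BooleanAlgebra booleanAlgebra public

  -- The natural order of the lattice: x ≤ y is x ≈ x ∧ y.
  _≤_ : Rel Carrier ℓ
  _≤_ = OrderTheoretic.Lattice._≤_
    (BooleanAlgebraProperties.∨-∧-orderTheoreticLattice booleanAlgebra)

  field
    _⇾_        : Op₂ Carrier
    ⇾-cong     : Congruent₂ _≈_ _⇾_
    ⇾-⊤        : ∀ a → (a ⇾ ⊤) ≈ ⊤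
    ⇾-distribˡ : ∀ a b c → ((a ⇾ b) ∧ (a ⇾ c)) ≈ (a ⇾ (b ∧ c))
    ⇾-∨-≤      : ∀ a b c → ((a ∨ b) ⇾ c) ≤ ((a ⇾ c) ∧ (b ⇾ c))

module Canonical {c ℓ} (𝐀 : ConditionalAlgebra c ℓ) where
  open ConditionalAlgebra 𝐀

  -- Not required to be proper: the whole algebra is a filter.
  record Filter : Set (suc (c ⊔ ℓ)) where
    field
      set      : Pred Carrier (c ⊔ ℓ)
      ⊤-closed : ⊤ ∈ set
      ∧-closed : ∀ {a b} → a ∈ set → b ∈ set → (a ∧ b) ∈ set
      ≤-closed : ∀ {a b} → a ≤ b → a ∈ set → b ∈ set

  Proper : Filter → Set (c ⊔ ℓ)
  Proper F = Not (∀ a → a ∈ Filter.set F)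

  record Ul : Set (suc (c ⊔ ℓ)) where
    field
      filter  : Filter
      proper  : Proper filter
      maximal : ∀ G → Proper G →
                Filter.set filter ⊆ Filter.set G → Filter.set G ⊆ Filter.set filter

    open Filter filter public

  -- Ultrafilters are compared by having the same elements.
  singleton : Ul → Pred Ul (c ⊔ ℓ)
  singleton u v = Ul.set v ≐ Ul.set u

  φ : Filter → Pred Ul (c ⊔ ℓ)
  φ F u = Filter.set F ⊆ Ul.set u

  Closed : ∀ {p} → Pred Ul p → Set (suc (c ⊔ ℓ) ⊔ p)
  Closed Z = ∃[ F ] Z ≐ φ F

  D : Ul → Filter → Pred Carrier (c ⊔ ℓ)
  D u F b = ∃[ a ] a ∈ Filter.set F × (a ⇾ b) ∈ Ul.set u

  T : ∀ {p} → Ul → Pred Ul p → Pred Ul (suc (c ⊔ ℓ) ⊔ p)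
  T u Z v = ∃[ F ] Z ≐ φ F × D u F ⊆ Ul.set v

{-# OPTIONS --safe #-}

-- By the ultrafilter theorem a filter is the intersection of the ultrafilters above it.  Hence F
-- is determined by φ F, so that T u (φ F) v holds exactly when D u F ⊆ v, and, since D u (↑ a)
-- is itself a filter, a ⇾ b ∈ u iff b lies in every v with T u (φ (↑ a)) v.  This modal reading
-- of ⇾ turns each condition on T into its inequality.  Conversely, the inequalities (A4), (A5)
-- and (A7) give their conditions by unfolding D; for (A6) and (A8) one extends the join of F
-- with D u v, respectively with D u (↑ ⊤), to ultrafilters.
module Submission where

open import Defs
open import Level using (suc; _⊔_; Lift; lift; lower)
open import Algebra.Lattice.Bundles using (BooleanAlgebra)
import Algebra.Lattice.Properties.BooleanAlgebra as BooleanAlgebraProperties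
open import Axiom.ExcludedMiddle using (ExcludedMiddle)
open import Data.Product using (_×_; ∃-syntax; _,_; proj₁; proj₂)
open import Data.Sum using (_⊎_; inj₁; inj₂)
open import Function.Base using (id; _∘_)
open import Function.Bundles using (_⇔_; mk⇔)
open import Relation.Binary.Bundles using (Poset)
import Relation.Binary.Lattice.Bundles as OrderTheoretic
import Relation.Binary.Lattice.Properties.JoinSemilattice as JoinProperties
import Relation.Binary.Lattice.Properties.MeetSemilattice as MeetProperties
open import Relation.Nullary.Decidable using (Dec; map′; True; toWitness; fromWitness; decidable-stable)
open import Relation.Nullary.Negation using () renaming (¬_ to Not_)
open import Relation.Unary using (Pred; _∈_; _∉_; _⊆_; _≐_; _∩_; U)

-- Order facts in a Boolean algebra

module BooleanOrder {c ℓ} (B : BooleanAlgebra c ℓ) where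
  open BooleanAlgebra B
  open BooleanAlgebraProperties B
    using (∨-∧-orderTheoreticLattice; ∧-identityʳ; ∧-zeroʳ; ∨-identityʳ; ¬-involutive)
  open OrderTheoretic.Lattice ∨-∧-orderTheoreticLattice public
    using (_≤_; x∧y≤x; x∧y≤y; ∧-greatest; y≤x∨y; ∨-least)
    renaming (refl to ≤-refl; trans to ≤-trans; reflexive to ≤-reflexive)
  open JoinProperties (OrderTheoretic.Lattice.joinSemilattice ∨-∧-orderTheoreticLattice) public
    using (∨-monotonic)
  open MeetProperties (OrderTheoretic.Lattice.meetSemilattice ∨-∧-orderTheoreticLattice) public
    using (∧-monotonic)

  ≤-⊤ : ∀ x → x ≤ ⊤
  ≤-⊤ x = sym (∧-identityʳ x)

  ⊥-≤ : ∀ x → ⊥ ≤ x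
  ⊥-≤ x = ≤-trans (≤-reflexive (sym (∧-zeroʳ x))) (x∧y≤x x ⊥)

  -- Complementation splits `x` as `(x ∧ ¬ y) ∨ (x ∧ y)`; the first part lies below `¬ y`, the
  -- second below `z`.
  ∧-residual : ∀ {x y z} → x ∧ y ≤ z → x ≤ ¬ y ∨ z
  ∧-residual {x} {y} {z} x∧y≤z = ≤-trans
    (≤-reflexive (trans (sym (∧-identityʳ x))
      (trans (∧-congˡ (sym (∨-complementˡ y))) (∧-distribˡ-∨ x (¬ y) y))))
    (∨-monotonic (x∧y≤y x (¬ y)) x∧y≤z)

  ∧-modusPonens : ∀ x y → x ∧ (¬ x ∨ y) ≤ y
  ∧-modusPonens x y = ≤-trans (≤-reflexive (∧-distribˡ-∨ x (¬ x) y))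
    (∨-least (≤-trans (≤-reflexive (∧-complementʳ x)) (⊥-≤ y)) (x∧y≤y x y))

  disjoint⇒≤¬ : ∀ {x y} → x ∧ y ≤ ⊥ → x ≤ ¬ y
  disjoint⇒≤¬ x∧y≤⊥ = ≤-trans (∧-residual x∧y≤⊥) (≤-reflexive (∨-identityʳ _))

  disjoint-¬⇒≤ : ∀ {x y} → x ∧ ¬ y ≤ ⊥ → x ≤ y
  disjoint-¬⇒≤ x∧¬y≤⊥ = ≤-trans (disjoint⇒≤¬ x∧¬y≤⊥) (≤-reflexive (¬-involutive _))

-- Monotonicity of `⇾`, filters and the relation `T`

module Conditional {c ℓ} (𝐀 : ConditionalAlgebra c ℓ) where
  open ConditionalAlgebra 𝐀
  open BooleanOrder booleanAlgebra hiding (_≤_)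
  open Canonical 𝐀
  open Filter using (⊤-closed; ∧-closed; ≤-closed)

  ⇾-monoʳ : ∀ a {b d} → b ≤ d → (a ⇾ b) ≤ (a ⇾ d)
  -- `b ≤ d` is by definition `b ≈ b ∧ d`, so distributivity already has the shape of the required
  -- inequality.
  ⇾-monoʳ a {b} {d} b≤d = trans (⇾-cong refl b≤d) (sym (⇾-distribˡ a b d))

  ⇾-antiˡ : ∀ {a a′} b → a ≤ a′ → (a′ ⇾ b) ≤ (a ⇾ b)
  ⇾-antiˡ {a} {a′} b a≤a′ = ≤-trans
    (≤-reflexive (⇾-cong (sym a∨a′≈a′) refl))
    (≤-trans (⇾-∨-≤ a a′ b) (x∧y≤x _ _))
    where
    a∨a′≈a′ : a ∨ a′ ≈ a′
    a∨a′≈a′ = OrderTheoretic.Lattice.antisym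
      (BooleanAlgebraProperties.∨-∧-orderTheoreticLattice booleanAlgebra)
      (∨-least a≤a′ ≤-refl) (y≤x∨y a a′)

  ↑ : Carrier → Filter
  ↑ a = record
    { set      = λ x → Lift c (a ≤ x)
    ; ⊤-closed = lift (≤-⊤ a)
    ; ∧-closed = λ (lift p) (lift q) → lift (∧-greatest p q)
    ; ≤-closed = λ x≤y (lift p) → lift (≤-trans p x≤y)
    }

  ∈-↑ : ∀ a → a ∈ Filter.set (↑ a)
  ∈-↑ a = lift ≤-refl

  infixr 6 _⊔ᶠ_

  _⊔ᶠ_ : Filter → Filter → Filter
  F ⊔ᶠ G = record
    { set      = λ x → ∃[ f ] ∃[ g ] f ∈ Filter.set F × g ∈ Filter.set G × f ∧ g ≤ x
    ; ⊤-closed = ⊤ , ⊤ , ⊤-closed F , ⊤-closed G , ≤-⊤ _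
    ; ∧-closed = λ (f , g , f∈F , g∈G , f∧g≤x) (f′ , g′ , f′∈F , g′∈G , f′∧g′≤y) →
        f ∧ f′ , g ∧ g′ , ∧-closed F f∈F f′∈F , ∧-closed G g∈G g′∈G ,
        ∧-greatest
          (≤-trans (∧-monotonic (x∧y≤x f f′) (x∧y≤x g g′)) f∧g≤x)
          (≤-trans (∧-monotonic (x∧y≤y f f′) (x∧y≤y g g′)) f′∧g′≤y)
    ; ≤-closed = λ x≤y (f , g , f∈F , g∈G , f∧g≤x) → f , g , f∈F , g∈G , ≤-trans f∧g≤x x≤y
    }

  ⊆-⊔ᶠˡ : ∀ F G → Filter.set F ⊆ Filter.set (F ⊔ᶠ G)
  ⊆-⊔ᶠˡ F G {x} x∈F = x , ⊤ , x∈F , ⊤-closed G , x∧y≤x x ⊤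

  ⊆-⊔ᶠʳ : ∀ F G → Filter.set G ⊆ Filter.set (F ⊔ᶠ G)
  ⊆-⊔ᶠʳ F G {x} x∈G = ⊤ , x , ⊤-closed F , x∈G , x∧y≤y ⊤ x

  ⊥∉⇒Proper : ∀ F → ⊥ ∉ Filter.set F → Proper F
  ⊥∉⇒Proper F ⊥∉F all = ⊥∉F (all ⊥)

  Proper⇒⊥∉ : ∀ F → Proper F → ⊥ ∉ Filter.set F
  Proper⇒⊥∉ F proper ⊥∈F = proper λ a → ≤-closed F (⊥-≤ a) ⊥∈F

  ¬∈⇒∉ : ∀ (u : Ul) {a} → (¬ a) ∈ Ul.set u → a ∉ Ul.set u
  ¬∈⇒∉ u {a} ¬a∈u a∈u = Proper⇒⊥∉ (Ul.filter u) (Ul.proper u)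
    (Ul.≤-closed u (≤-reflexive (∧-complementʳ a)) (Ul.∧-closed u a∈u ¬a∈u))

  -- Points are closed: by maximality of `u`, an ultrafilter that includes `u` has the same
  -- elements.
  singleton≐φ : ∀ u → singleton u ≐ φ (Ul.filter u)
  singleton≐φ u = proj₂ , λ {v} u⊆v → Ul.maximal u (Ul.filter v) (Ul.proper v) u⊆v , u⊆v

  -- Two witnesses `a` and `a′` are replaced by `a ∧ a′`: `⇾` is antitone on the left, and with a
  -- common antecedent it distributes over meets.
  Dᶠ : Ul → Filter → Filter
  Dᶠ u F = record
    { set      = D u F
    ; ⊤-closed = ⊤ , ⊤-closed F , Ul.≤-closed u (≤-reflexive (sym (⇾-⊤ ⊤))) (Ul.⊤-closed u)
    ; ∧-closed = λ {b} {b′} (a , a∈F , a⇾b∈u) (a′ , a′∈F , a′⇾b′∈u) →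
        a ∧ a′ , ∧-closed F a∈F a′∈F ,
        Ul.≤-closed u
          (≤-trans (∧-monotonic (⇾-antiˡ b (x∧y≤x a a′)) (⇾-antiˡ b′ (x∧y≤y a a′)))
            (≤-reflexive (⇾-distribˡ (a ∧ a′) b b′)))
          (Ul.∧-closed u a⇾b∈u a′⇾b′∈u)
    ; ≤-closed = λ b≤b′ (a , a∈F , a⇾b∈u) → a , a∈F , Ul.≤-closed u (⇾-monoʳ a b≤b′) a⇾b∈u
    }

  -- Among the elements above `a`, `a` itself is the best witness, again by antitonicity on the
  -- left.
  ∈-D-↑ : ∀ (u : Ul) {a b} → b ∈ D u (↑ a) → (a ⇾ b) ∈ Ul.set u
  ∈-D-↑ u {b = b} (x , lift a≤x , x⇾b∈u) = Ul.≤-closed u (⇾-antiˡ b a≤x) x⇾b∈u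

  -- Every filter contains `⊤`, so `⊤ ⇾_` acts as a box along all `T`-steps from `u`, whatever the
  -- closed set `Y`.
  T-⊤ : ∀ {p} u v {Y : Pred Ul p} {b} → T u Y v → (⊤ ⇾ b) ∈ Ul.set u → b ∈ Ul.set v
  T-⊤ u v (F , _ , D⊆v) ⊤⇾b∈u = D⊆v (⊤ , ⊤-closed F , ⊤⇾b∈u)

  φ-closed : ∀ F → Closed (φ F)
  φ-closed F = F , id , id

-- The ultrafilter theorem from Zorn's lemma

module Classical {c ℓ} (em : ExcludedMiddle (suc (c ⊔ ℓ)))
                 (zorn : ZornsLemma (suc (c ⊔ ℓ)) (c ⊔ ℓ) (c ⊔ ℓ))
                 (𝐀 : ConditionalAlgebra c ℓ) where
  open ConditionalAlgebra 𝐀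
  open BooleanOrder booleanAlgebra hiding (_≤_)
  open BooleanAlgebraProperties booleanAlgebra using (¬-involutive)
  open Canonical 𝐀
  open Conditional 𝐀
  open Filter using (⊤-closed; ∧-closed; ≤-closed)

  -- Excluded middle is assumed one universe higher, so `P` is lifted there and the decision brought
  -- back.
  decide : (P : Set (c ⊔ ℓ)) → Dec P
  decide P = map′ lower lift (em {Lift (suc (c ⊔ ℓ)) P})

  module _ (F : Filter) (⊥∉F : ⊥ ∉ Filter.set F) where

    ProperExtension : Set (suc (c ⊔ ℓ))
    ProperExtension = ∃[ G ] Filter.set F ⊆ Filter.set G × ⊥ ∉ Filter.set G

    set : ProperExtension → Pred Carrier (c ⊔ ℓ)
    set (G , _) = Filter.set G

    properExtensions : Poset (suc (c ⊔ ℓ)) (c ⊔ ℓ) (c ⊔ ℓ)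
    properExtensions = record
      { Carrier        = ProperExtension
      ; _≈_            = λ G H → set G ≐ set H
      ; _≤_            = λ G H → set G ⊆ set H
      ; isPartialOrder = record
        { isPreorder = record
          { isEquivalence = record
            { refl  = id , id
            ; sym   = λ (p , q) → q , p
            ; trans = λ (p , q) (p′ , q′) → p′ ∘ p , q ∘ q′
            }
          ; reflexive = λ p → proj₁ p
          ; trans     = λ p q → q ∘ p
          }
        ; antisym = λ p q → p , q
        }
      }

    module _ (C : Pred ProperExtension (suc (c ⊔ ℓ)))
             (chain : ∀ {G H} → G ∈ C → H ∈ C → set G ⊆ set H ⊎ set H ⊆ set G) where

      -- The summand F covers the empty chain.
      InUnion : Carrier → Set (suc (c ⊔ ℓ))
      InUnion x = x ∈ Filter.set F ⊎ ∃[ G ] G ∈ C × x ∈ set G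

      -- InUnion quantifies over filters and so lives one universe too high for a filter;
      -- excluded middle resizes it.
      Union : Pred Carrier (c ⊔ ℓ)
      Union x = Lift (c ⊔ ℓ) (True (em {InUnion x}))

      toUnion : ∀ {x} → InUnion x → x ∈ Union
      toUnion = lift ∘ fromWitness

      fromUnion : ∀ {x} → x ∈ Union → InUnion x
      fromUnion = toWitness ∘ lower

      InUnion-∧ : ∀ {x y} → InUnion x → InUnion y → InUnion (x ∧ y)
      InUnion-∧ (inj₁ x∈F) (inj₁ y∈F) = inj₁ (∧-closed F x∈F y∈F)
      InUnion-∧ (inj₁ x∈F) (inj₂ (G@(G′ , F⊆G , _) , G∈C , y∈G)) =
        inj₂ (G , G∈C , ∧-closed G′ (F⊆G x∈F) y∈G)
      InUnion-∧ (inj₂ (G@(G′ , F⊆G , _) , G∈C , x∈G)) (inj₁ y∈F) =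
        inj₂ (G , G∈C , ∧-closed G′ x∈G (F⊆G y∈F))
      InUnion-∧ (inj₂ (G@(G′ , _) , G∈C , x∈G)) (inj₂ (H@(H′ , _) , H∈C , y∈H))
        with chain G∈C H∈C
      ... | inj₁ G⊆H = inj₂ (H , H∈C , ∧-closed H′ (G⊆H x∈G) y∈H)
      ... | inj₂ H⊆G = inj₂ (G , G∈C , ∧-closed G′ x∈G (H⊆G y∈H))

      InUnion-≤ : ∀ {x y} → x ≤ y → InUnion x → InUnion y
      InUnion-≤ x≤y (inj₁ x∈F) = inj₁ (≤-closed F x≤y x∈F)
      InUnion-≤ x≤y (inj₂ (G@(G′ , _) , G∈C , x∈G)) = inj₂ (G , G∈C , ≤-closed G′ x≤y x∈G)

      ¬InUnion-⊥ : Not InUnion ⊥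
      ¬InUnion-⊥ (inj₁ ⊥∈F) = ⊥∉F ⊥∈F
      ¬InUnion-⊥ (inj₂ ((_ , _ , ⊥∉G) , _ , ⊥∈G)) = ⊥∉G ⊥∈G

      upperBound : ∃[ B ] (∀ {G} → G ∈ C → set G ⊆ set B)
      upperBound = (union , toUnion ∘ inj₁ , ¬InUnion-⊥ ∘ fromUnion) ,
                   λ {G} G∈C x∈G → toUnion (inj₂ (G , G∈C , x∈G))
        where
        union : Filter
        union = record
          { set      = Union
          ; ⊤-closed = toUnion (inj₁ (⊤-closed F))
          ; ∧-closed = λ p q → toUnion (InUnion-∧ (fromUnion p) (fromUnion q))
          ; ≤-closed = λ x≤y p → toUnion (InUnion-≤ x≤y (fromUnion p))
          }

    ultrafilterTheorem : ∃[ u ] u ∈ φ F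
    ultrafilterTheorem with zorn properExtensions upperBound
    ... | (M , F⊆M , ⊥∉M) , maximal = record
      { filter  = M
      ; proper  = ⊥∉⇒Proper M ⊥∉M
      -- A proper filter above `M` also contains `F`, so it belongs to the poset; maximality there
      -- is maximality among all proper filters.
      ; maximal = λ G proper M⊆G → maximal {G , M⊆G ∘ F⊆M , Proper⇒⊥∉ G proper} M⊆G
      } , F⊆M

  -- Separation by ultrafilters and the modal reading of `⇾`

  ∉⇒separated : ∀ F {a} → a ∉ Filter.set F → ∃[ u ] u ∈ φ F × a ∉ Ul.set u
  ∉⇒separated F {a} a∉F =
    let u , F⊔¬a⊆u = ultrafilterTheorem (F ⊔ᶠ ↑ (¬ a)) λ (f , g , f∈F , lift ¬a≤g , f∧g≤⊥) →
          -- Were the join improper, some `f ∈ F` would be disjoint from `¬ a`, hence below `a`.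
          a∉F (≤-closed F (disjoint-¬⇒≤ (≤-trans (∧-monotonic ≤-refl ¬a≤g) f∧g≤⊥)) f∈F)
    in u , F⊔¬a⊆u ∘ ⊆-⊔ᶠˡ F (↑ (¬ a)) ,
       ¬∈⇒∉ u (F⊔¬a⊆u (⊆-⊔ᶠʳ F (↑ (¬ a)) (∈-↑ (¬ a))))

  φ-reflects-⊆ : ∀ F G → φ F ⊆ φ G → Filter.set G ⊆ Filter.set F
  φ-reflects-⊆ F G φF⊆φG {a} a∈G = decidable-stable (decide _) λ a∉F →
    let u , F⊆u , a∉u = ∉⇒separated F a∉F in a∉u (φF⊆φG {u} F⊆u a∈G)

  -- If `¬ a` were missing too, the join of `u` with `↑ a` would be proper, and maximality would put
  -- `a` into `u`.
  ∉⇒¬∈ : ∀ (u : Ul) {a} → a ∉ Ul.set u → (¬ a) ∈ Ul.set u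
  ∉⇒¬∈ u {a} a∉u = decidable-stable (decide _) λ ¬a∉u →
    a∉u (Ul.maximal u G
      (⊥∉⇒Proper G λ (f , g , f∈u , lift a≤g , f∧g≤⊥) →
        ¬a∉u (Ul.≤-closed u (disjoint⇒≤¬ (≤-trans (∧-monotonic ≤-refl a≤g) f∧g≤⊥)) f∈u))
      (⊆-⊔ᶠˡ (Ul.filter u) (↑ a))
      (⊆-⊔ᶠʳ (Ul.filter u) (↑ a) (∈-↑ a)))
    where
    G : Filter
    G = Ul.filter u ⊔ᶠ ↑ a

  ¬∉⇒∈ : ∀ (u : Ul) {a} → (¬ a) ∉ Ul.set u → a ∈ Ul.set u
  ¬∉⇒∈ u ¬a∉u = decidable-stable (decide _) (¬a∉u ∘ ∉⇒¬∈ u)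

  ≤-fromUl : ∀ {a b} → (∀ u → a ∈ Ul.set u → b ∈ Ul.set u) → a ≤ b
  ≤-fromUl {a} {b} h = lower (φ-reflects-⊆ (↑ a) (↑ b)
    (λ {u} ↑a⊆u (lift b≤x) → Ul.≤-closed u b≤x (h u (↑a⊆u (∈-↑ a))))
    (∈-↑ b))

  -- The ultrafilters above the filter `D u (↑ a)` are all `T`-successors of `u` along `φ (↑ a)`; if
  -- `b` lies in each of them, it lies in the filter.
  ⇾-intro : ∀ u {a b} → (∀ v → T u (φ (↑ a)) v → b ∈ Ul.set v) → (a ⇾ b) ∈ Ul.set u
  ⇾-intro u {a} {b} h = ∈-D-↑ u (φ-reflects-⊆ (Dᶠ u (↑ a)) (↑ b)
    (λ {v} D⊆v (lift b≤x) → Ul.≤-closed v b≤x (h v (↑ a , (id , id) , D⊆v)))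
    (∈-↑ b))

  -- The filter `G` inside the proof of `T u Y v` may differ from `F`, but both cut out `Y`, so `F`
  -- is included in `G`.
  ⇾-elim : ∀ {p} u v {Y : Pred Ul p} {a b} F → Y ≐ φ F → T u Y v →
           a ∈ Filter.set F → (a ⇾ b) ∈ Ul.set u → b ∈ Ul.set v
  ⇾-elim u v {a = a} F Y≐φF (G , Y≐φG , D⊆v) a∈F a⇾b∈u =
    D⊆v (a , φ-reflects-⊆ G F (λ {w} → proj₁ Y≐φF {w} ∘ proj₂ Y≐φG {w}) a∈F , a⇾b∈u)

  ⇾-elim-↑ : ∀ u v {a b} → T u (φ (↑ a)) v → (a ⇾ b) ∈ Ul.set u → b ∈ Ul.set v
  ⇾-elim-↑ u v {a} t = ⇾-elim u v (↑ a) (id , id) t (∈-↑ a)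

  -- Correspondence between inequalities and conditions on `T`

  A4 : (∀ a b d → (a ⇾ b) ≤ (d ⇾ (a ⇾ b)))
    ⇔ (∀ u v w (Y Z : Pred Ul (c ⊔ ℓ)) → Closed Y → Closed Z →
        T u Y v → T v Z w → T u Z w)
  A4 = mk⇔
    -- The instance `d = ⊤` suffices: it puts `⊤ ⇾ (a ⇾ b)` into `u`, and `T-⊤` carries `a ⇾ b` to
    -- `v`.
    (λ ax u v w Y Z _ _ Tuv (G , Z≐φG , D⊆w) → G , Z≐φG , λ {b} (a , a∈G , a⇾b∈u) →
      D⊆w (a , a∈G , T-⊤ u v Tuv (Ul.≤-closed u (ax a b ⊤) a⇾b∈u)))
    (λ trans a b d → ≤-fromUl λ u a⇾b∈u → ⇾-intro u λ v Tuv → ⇾-intro v λ w Tvw →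
      ⇾-elim-↑ u w
        (trans u v w (φ (↑ d)) (φ (↑ a)) (φ-closed (↑ d)) (φ-closed (↑ a)) Tuv Tvw) a⇾b∈u)

  A5 : (∀ a b → (a ∧ (a ⇾ b)) ≤ b) ⇔ (∀ u → T u (singleton u) u)
  A5 = mk⇔
    (λ ax u → Ul.filter u , singleton≐φ u , λ {b} (a , a∈u , a⇾b∈u) →
      Ul.≤-closed u (ax a b) (Ul.∧-closed u a∈u a⇾b∈u))
    -- The closed set is the point `u`, whose filter contains `a`, so `⇾-elim` applies with `u` as
    -- its own successor.
    (λ centred a b → ≤-fromUl λ u a∧[a⇾b]∈u →
      ⇾-elim u u (Ul.filter u) (singleton≐φ u) (centred u)
        (Ul.≤-closed u (x∧y≤x _ _) a∧[a⇾b]∈u)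
        (Ul.≤-closed u (x∧y≤y _ _) a∧[a⇾b]∈u))

  A6 : (∀ a b → (a ⇾ b) ≤ ((¬ b) ⇾ (¬ a)))
    ⇔ (∀ u v (Y : Pred Ul (c ⊔ ℓ)) → Closed Y →
        T u Y v → ∃[ w ] (w ∈ Y × T u (singleton v) w))
  -- If `a ∈ v`, the point `w` supplied by the condition contains `¬ b`, yet as a successor of `u`
  -- along the point `v` it also contains `b`.
  A6 = mk⇔ to λ h a b → ≤-fromUl λ u a⇾b∈u → ⇾-intro u λ v Tuv → ∉⇒¬∈ v λ a∈v →
      let w , ¬b∈w , Tuw = h u v (φ (↑ (¬ b))) (φ-closed (↑ (¬ b))) Tuv
      in ¬∈⇒∉ w (¬b∈w (∈-↑ (¬ b))) (⇾-elim u w (Ul.filter v) (singleton≐φ v) Tuw a∈v a⇾b∈u)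
    where
    to : (∀ a b → (a ⇾ b) ≤ ((¬ b) ⇾ (¬ a))) →
         ∀ u v (Y : Pred Ul (c ⊔ ℓ)) → Closed Y →
         T u Y v → ∃[ w ] (w ∈ Y × T u (singleton v) w)
    to ax u v Y _ (F , Y≐φF , D⊆v) =
      w , proj₂ Y≐φF {w} (J⊆w ∘ ⊆-⊔ᶠʳ Dv F) ,
      Ul.filter v , singleton≐φ v , J⊆w ∘ ⊆-⊔ᶠˡ Dv F
      where
      Dv = Dᶠ u (Ul.filter v)

      ⊥∉J : ⊥ ∉ Filter.set (Dv ⊔ᶠ F)
      -- From `d ≤ ¬ f` follows `x ⇾ d ≤ x ⇾ ¬ f ≤ ¬ ¬ f ⇾ ¬ x`. As `¬ ¬ f ∈ F`, this puts `¬ x`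
      -- into `D u F`, hence into `v`, against `x ∈ v`.
      ⊥∉J (d , f , (x , x∈v , x⇾d∈u) , f∈F , d∧f≤⊥) = ¬∈⇒∉ v
        (D⊆v (¬ ¬ f , ≤-closed F (≤-reflexive (sym (¬-involutive f))) f∈F ,
          Ul.≤-closed u (≤-trans (⇾-monoʳ x (disjoint⇒≤¬ d∧f≤⊥)) (ax x (¬ f))) x⇾d∈u))
        x∈v

      w   = proj₁ (ultrafilterTheorem (Dv ⊔ᶠ F) ⊥∉J)
      J⊆w = proj₂ (ultrafilterTheorem (Dv ⊔ᶠ F) ⊥∉J)

  A7 : (∀ a b d → (¬ (a ⇾ b)) ≤ (d ⇾ (¬ (a ⇾ b))))
    ⇔ (∀ u v w (Y Z : Pred Ul (c ⊔ ℓ)) → Closed Y → Closed Z →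
        T u Y v → T u Z w → T v Z w)
  A7 = mk⇔
    (λ ax u v w Y Z _ _ Tuv (G , Z≐φG , D⊆w) → G , Z≐φG , λ {b} (a , a∈G , a⇾b∈v) →
      -- Otherwise `¬ (a ⇾ b)` is in `u`, and the inequality at `d = ⊤` with `T-⊤` carries it to
      -- `v`.
      D⊆w (a , a∈G , ¬∉⇒∈ u λ ¬[a⇾b]∈u →
        ¬∈⇒∉ v (T-⊤ u v Tuv (Ul.≤-closed u (ax a b ⊤) ¬[a⇾b]∈u)) a⇾b∈v))
    (λ euclid a b d → ≤-fromUl λ u ¬[a⇾b]∈u → ⇾-intro u λ v Tuv → ∉⇒¬∈ v λ a⇾b∈v →
      -- Each successor `w` of `u` along `φ (↑ a)` is one of `v` too and so contains `b`; this
      -- forces `a ⇾ b` into `u`.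
      ¬∈⇒∉ u ¬[a⇾b]∈u (⇾-intro u λ w Tuw →
        ⇾-elim-↑ v w
          (euclid u v w (φ (↑ d)) (φ (↑ a)) (φ-closed (↑ d)) (φ-closed (↑ a)) Tuv Tuw) a⇾b∈v))

  A8 : (∀ a b d → ((⊤ ⇾ ((¬ a) ∨ b)) ∧ (b ⇾ d)) ≤ (a ⇾ d))
    ⇔ (∀ u v (Y Z : Pred Ul (c ⊔ ℓ)) → Closed Y → Closed Z →
        T u Y v → (T u U ∩ Y) ⊆ Z → T u Z v)
  A8 = mk⇔ to λ h a b d → ≤-fromUl λ u p → ⇾-intro u λ v Tuv →
      ⇾-elim-↑ u v
        (h u v (φ (↑ a)) (φ (↑ b)) (φ-closed (↑ a)) (φ-closed (↑ b)) Tuv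
          -- `w` contains `a` from `Y` and `¬ a ∨ b` through `T u U`, hence `b`.
          λ {w} (Tuw , ↑a⊆w) (lift b≤x) →
            Ul.≤-closed w (≤-trans (∧-modusPonens a b) b≤x)
              (Ul.∧-closed w (↑a⊆w (∈-↑ a)) (T-⊤ u w Tuw (Ul.≤-closed u (x∧y≤x _ _) p))))
        (Ul.≤-closed u (x∧y≤y _ _) p)
    where
    U≐φ↑⊤ : U ≐ φ (↑ ⊤)
    U≐φ↑⊤ = (λ {w} _ (lift ⊤≤x) → Ul.≤-closed w ⊤≤x (Ul.⊤-closed w)) , _

    to : (∀ a b d → ((⊤ ⇾ ((¬ a) ∨ b)) ∧ (b ⇾ d)) ≤ (a ⇾ d)) →
         ∀ u v (Y Z : Pred Ul (c ⊔ ℓ)) → Closed Y → Closed Z →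
         T u Y v → (T u U ∩ Y) ⊆ Z → T u Z v
    to ax u v Y Z _ (G , Z≐φG) (F , Y≐φF , D⊆v) TuU∩Y⊆Z = G , Z≐φG , D⊆
      where
      D⊤ = Dᶠ u (↑ ⊤)

      -- An ultrafilter above the join lies in both `T u U` and `Y`, hence in `Z`, which is `φ G`.
      G⊆J : Filter.set G ⊆ Filter.set (D⊤ ⊔ᶠ F)
      G⊆J = φ-reflects-⊆ (D⊤ ⊔ᶠ F) G λ {w} J⊆w → proj₁ Z≐φG {w} (TuU∩Y⊆Z {w}
        ((↑ ⊤ , U≐φ↑⊤ , J⊆w ∘ ⊆-⊔ᶠˡ D⊤ F) , proj₂ Y≐φF {w} (J⊆w ∘ ⊆-⊔ᶠʳ D⊤ F)))

      D⊆ : D u G ⊆ Ul.set v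
      D⊆ {b} (g , g∈G , g⇾b∈u) =
        -- Residuation turns `d ∧ f ≤ g` into `d ≤ ¬ f ∨ g`, so `⊤ ⇾ (¬ f ∨ g)` is in `u`; with
        -- `g ⇾ b` the inequality yields `f ⇾ b`, where `f ∈ F`.
        let d , f , d∈D⊤ , f∈F , d∧f≤g = G⊆J g∈G
        in D⊆v (f , f∈F , Ul.≤-closed u (ax f g b) (Ul.∧-closed u
             (Ul.≤-closed u (⇾-monoʳ ⊤ (∧-residual d∧f≤g)) (∈-D-↑ u d∈D⊤))
             g⇾b∈u))

theorem9p6 : ∀ {c ℓ} → ExcludedMiddle (suc (c ⊔ ℓ)) → ZornsLemma (suc (c ⊔ ℓ)) (c ⊔ ℓ) (c ⊔ ℓ) →
  (𝐀 : ConditionalAlgebra c ℓ) →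
  let open ConditionalAlgebra 𝐀
      open Canonical 𝐀
  in
  ((∀ a b d → (a ⇾ b) ≤ (d ⇾ (a ⇾ b)))
    ⇔ (∀ u v w (Y Z : Pred Ul (c ⊔ ℓ)) → Closed Y → Closed Z →
        T u Y v → T v Z w → T u Z w))
  ×
  ((∀ a b → (a ∧ (a ⇾ b)) ≤ b)
    ⇔ (∀ u → T u (singleton u) u))
  ×
  ((∀ a b → (a ⇾ b) ≤ ((¬ b) ⇾ (¬ a)))
    ⇔ (∀ u v (Y : Pred Ul (c ⊔ ℓ)) → Closed Y →
        T u Y v → ∃[ w ] (w ∈ Y × T u (singleton v) w)))
  ×
  ((∀ a b d → (¬ (a ⇾ b)) ≤ (d ⇾ (¬ (a ⇾ b))))
    ⇔ (∀ u v w (Y Z : Pred Ul (c ⊔ ℓ)) → Closed Y → Closed Z →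
        T u Y v → T u Z w → T v Z w))
  ×
  ((∀ a b d → ((⊤ ⇾ ((¬ a) ∨ b)) ∧ (b ⇾ d)) ≤ (a ⇾ d))
    ⇔ (∀ u v (Y Z : Pred Ul (c ⊔ ℓ)) → Closed Y → Closed Z →
        T u Y v → (T u U ∩ Y) ⊆ Z → T u Z v))
theorem9p6 em zorn 𝐀 = A4 , A5 , A6 , A7 , A8
  where open Classical em zorn 𝐀
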